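{- Let $L,M$ be bounded distributive lattices, $I$ an ideal of $L$, and $F$ a filter of $M$. Let $X$ be the Priestley space of $L$, $Y$ the Priestley space of $M$, $V$ the open upset of $X$ corresponding to the ideal $I$, $D:=X\setminus V$, and $U$ the closed upset of $Y$ corresponding to the filter $F$. Then the down-up sum $X\oplus_D^U Y$ is homeomorphic and order-isomorphic (by a single map) to the Priestley space of the ideal-filter product $L\times_I^F M$.
   Context: A Priestley space is a compact topological space $X$ with a partial order such that whenever $x\nleq y$ there is a clopen upset containing $x$ and missing $y$. The Priestley space of a bounded distributive lattice $L$ is the set $X$ of prime filters of $L$ ordered by inclusion, with topology given by the basis $\{\alpha(a)\setminus\alpha(b)\mid a,b\in L\}$, where $\alpha(a)=\{x\in X\mid a\in x\}$; $\alpha$ is an isomorphism of $L$ onto the lattice of clopen upsets of $X$. The open upset of $X$ corresponding to an ideal $I$ of $L$ is $\bigcup\{\alpha(a)\mid a\in I\}$, and the closed upset corresponding to a filter $F$ of a lattice is $\bigcap\{\alpha(a)\mid a\in F\}$ (computed in the Priestley space of that lattice). Ideal-filter product: for bounded distributive lattices $L,M$, an ideal $I$ of $L$ and a filter $F$ of $M$, $L\times_I^F M:=\{(l,m)\in L\times M\mid l\in I\text{ or }m\in F\}$, a bounded sublattice of $L\times M$. Down-up sum: for Priestley spaces $X,Y$ (assumed disjoint, replacing them by disjoint copies if necessary), a closed downset $D$ of $X$ and a closed upset $U$ of $Y$, $X\oplus_D^U Y$ is the disjoint union of $X$ and $Y$ with the disjoint union topology and the order: $x\le y$ iff ($x,y\in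 X$ and $x\le y$ in $X$) or ($x,y\in Y$ and $x\le y$ in $Y$) or ($x\in D$ and $y\in U$). -}

module Defs where

open import Axiom.ExcludedMiddle using (ExcludedMiddle)
import Data.Empty.Polymorphic as Empty
open import Data.Product.Base using (Σ; ∃; ∃₂; _×_; _,_; proj₁; proj₂)
open import Data.Product.Relation.Binary.Pointwise.NonDependent
  using (×-isPartialOrder)
open import Data.Sum.Base using (_⊎_; inj₁; inj₂)
open import Data.Sum.Relation.Binary.Pointwise
  using (Pointwise; inj₁; inj₂; ⊎-isEquivalence)
import Data.Unit.Polymorphic as Unit
open import Function.Base using (_∘_; id)
open import Function.Bundles using (Inverse)
open import Level using (Level; suc; _⊔_)
open import Relation.Binary.Bundles using (Poset)
open import Relation.Binary.Core using (Rel)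
open import Relation.Binary.Definitions
  using (Maximum; Minimum; _Respects_)
open import Relation.Binary.Lattice using (DistributiveLattice)
open import Relation.Binary.Morphism.Structures using (IsOrderIsomorphism)
import Relation.Binary.Construct.On as On
open import Relation.Nullary using (yes; no; contradiction)
open import Relation.Nullary.Decidable using (decidable-stable)
open import Relation.Unary
  using (Pred; _∈_; _∉_; _⊆_; _≐_; ∁; U; _∩_; ⋃; ⋂)

private
  variable
    c ℓ₁ ℓ : Level

record BoundedDistributiveLattice (ℓ : Level) : Set (suc ℓ) where
  field
    distributiveLattice : DistributiveLattice ℓ ℓ ℓ

  open DistributiveLattice distributiveLattice public

  field
    ⊤       : Carrier
    ⊥       : Carrier
    maximum : Maximum _≤_ ⊤
    minimum : Minimum _≤_ ⊥

module _ (L : BoundedDistributiveLattice ℓ) where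

  private module L = BoundedDistributiveLattice L
  open L using (Carrier; _≤_; _∨_; _∧_)

  -- Ideals and filters are not required to be proper; prime filters are.

  record IsIdeal (I : Pred Carrier ℓ) : Set ℓ where
    field
      ⊥∈         : L.⊥ ∈ I
      ∨-closed   : ∀ {a b} → a ∈ I → b ∈ I → a ∨ b ∈ I
      downClosed : ∀ {a b} → a ≤ b → b ∈ I → a ∈ I

  record IsFilter (F : Pred Carrier ℓ) : Set ℓ where
    field
      ⊤∈       : L.⊤ ∈ F
      ∧-closed : ∀ {a b} → a ∈ F → b ∈ F → a ∧ b ∈ F
      upClosed : ∀ {a b} → a ≤ b → a ∈ F → b ∈ F

  record IsPrimeFilter (F : Pred Carrier ℓ) : Set ℓ where
    field
      isFilter : IsFilter F
      proper   : L.⊥ ∉ F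
      prime    : ∀ {a b} → a ∨ b ∈ F → a ∈ F ⊎ b ∈ F

    open IsFilter isFilter public

  record Ideal : Set (suc ℓ) where
    field
      member  : Pred Carrier ℓ
      isIdeal : IsIdeal member
    open IsIdeal isIdeal public

  record Filter : Set (suc ℓ) where
    field
      member   : Pred Carrier ℓ
      isFilter : IsFilter member
    open IsFilter isFilter public

  record PrimeFilter : Set (suc ℓ) where
    field
      member        : Pred Carrier ℓ
      isPrimeFilter : IsPrimeFilter member
    open IsPrimeFilter isPrimeFilter public

  α : Carrier → Pred PrimeFilter ℓ
  α a x = a ∈ PrimeFilter.member x

infixr 2 _×ᴸ_

_×ᴸ_ : (L M : BoundedDistributiveLattice ℓ) → BoundedDistributiveLattice ℓ
L ×ᴸ M = record
  { distributiveLattice = record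
    { Carrier = L.Carrier × M.Carrier
    ; _∨_     = λ (l , m) (l′ , m′) → (l L.∨ l′) , (m M.∨ m′)
    ; _∧_     = λ (l , m) (l′ , m′) → (l L.∧ l′) , (m M.∧ m′)
    ; isDistributiveLattice = record
      { isLattice = record
        { isPartialOrder = ×-isPartialOrder L.isPartialOrder M.isPartialOrder
        ; supremum = λ (l , m) (l′ , m′) →
            (L.x≤x∨y l l′ , M.x≤x∨y m m′) ,
            (L.y≤x∨y l l′ , M.y≤x∨y m m′) ,
            λ _ (p , q) (p′ , q′) → L.∨-least p p′ , M.∨-least q q′
        ; infimum = λ (l , m) (l′ , m′) →
            (L.x∧y≤x l l′ , M.x∧y≤x m m′) ,
            (L.x∧y≤y l l′ , M.x∧y≤y m m′) ,
            λ _ (p , q) (p′ , q′) → L.∧-greatest p p′ , M.∧-greatest q q′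
        }
      ; ∧-distribˡ-∨ = λ (l , m) (l′ , m′) (l″ , m″) →
          L.∧-distribˡ-∨ l l′ l″ , M.∧-distribˡ-∨ m m′ m″
      }
    }
  ; ⊤       = L.⊤ , M.⊤
  ; ⊥       = L.⊥ , M.⊥
  ; maximum = λ (l , m) → L.maximum l , M.maximum m
  ; minimum = λ (l , m) → L.minimum l , M.minimum m
  }
  where
  module L = BoundedDistributiveLattice L
  module M = BoundedDistributiveLattice M

module _ (N : BoundedDistributiveLattice ℓ) where

  private module N = BoundedDistributiveLattice N

  record IsBoundedSublattice (P : Pred N.Carrier ℓ) : Set ℓ where
    field
      ⊤∈       : N.⊤ ∈ P
      ⊥∈       : N.⊥ ∈ P
      ∨-closed : ∀ {a b} → a ∈ P → b ∈ P → a N.∨ b ∈ P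
      ∧-closed : ∀ {a b} → a ∈ P → b ∈ P → a N.∧ b ∈ P

  boundedSublattice : (P : Pred N.Carrier ℓ) → IsBoundedSublattice P →
                      BoundedDistributiveLattice ℓ
  boundedSublattice P isSub = record
    { distributiveLattice = record
      { Carrier = Σ N.Carrier P
      ; _∨_     = λ (a , p) (b , q) → (a N.∨ b) , ∨-closed p q
      ; _∧_     = λ (a , p) (b , q) → (a N.∧ b) , ∧-closed p q
      ; isDistributiveLattice = record
        { isLattice = record
          { isPartialOrder = On.isPartialOrder proj₁ N.isPartialOrder
          ; supremum = λ (a , _) (b , _) →
              N.x≤x∨y a b , N.y≤x∨y a b , λ _ → N.∨-least
          ; infimum  = λ (a , _) (b , _) →
              N.x∧y≤x a b , N.x∧y≤y a b , λ _ → N.∧-greatest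
          }
        ; ∧-distribˡ-∨ = λ (a , _) (b , _) (d , _) → N.∧-distribˡ-∨ a b d
        }
      }
    ; ⊤       = N.⊤ , ⊤∈
    ; ⊥       = N.⊥ , ⊥∈
    ; maximum = λ (a , _) → N.maximum a
    ; minimum = λ (a , _) → N.minimum a
    }
    where open IsBoundedSublattice isSub

module _ (L M : BoundedDistributiveLattice ℓ) (I : Ideal L) (F : Filter M) where

  private
    module L = BoundedDistributiveLattice L
    module M = BoundedDistributiveLattice M
    module I = Ideal I
    module F = Filter F

  idealFilterMember : Pred (L.Carrier × M.Carrier) ℓ
  idealFilterMember (l , m) = l ∈ I.member ⊎ m ∈ F.member

  idealFilter-isBoundedSublattice :
    IsBoundedSublattice (L ×ᴸ M) idealFilterMember
  idealFilter-isBoundedSublattice = record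
    { ⊤∈       = inj₂ F.⊤∈
    ; ⊥∈       = inj₁ I.⊥∈
    ; ∨-closed = λ where
        (inj₁ p) (inj₁ q) → inj₁ (I.∨-closed p q)
        (inj₁ p) (inj₂ q) → inj₂ (F.upClosed (M.y≤x∨y _ _) q)
        (inj₂ p) _        → inj₂ (F.upClosed (M.x≤x∨y _ _) p)
    ; ∧-closed = λ where
        (inj₂ p) (inj₂ q) → inj₂ (F.∧-closed p q)
        (inj₂ p) (inj₁ q) → inj₁ (I.downClosed (L.x∧y≤y _ _) q)
        (inj₁ p) _        → inj₁ (I.downClosed (L.x∧y≤x _ _) p)
    }

  idealFilterProduct : BoundedDistributiveLattice ℓ
  idealFilterProduct =
    boundedSublattice (L ×ᴸ M) idealFilterMember idealFilter-isBoundedSublattice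

-- Points form a setoid, so open sets must respect its equality.  In the
-- union axiom, the index type is large enough for a family consisting of
-- arbitrarily many predicates at level ℓ.  The union of such a family may
-- live in a larger universe, so the axiom concerns the predicates T at
-- level ℓ extensionally equal to it.

record IsTopology {X : Set c} (_≈_ : Rel X ℓ₁)
                  (Open : Pred X ℓ → Set (c ⊔ ℓ)) :
                  Set (ℓ₁ ⊔ suc (c ⊔ suc ℓ)) where
  field
    open-resp : ∀ {S} → Open S → S Respects _≈_
    open-U    : ∀ {S} → S ≐ U → Open S
    open-∩    : ∀ {S T} → Open S → Open T → Open (S ∩ T)
    open-⋃    : ∀ {J : Set (c ⊔ suc ℓ)} (S : J → Pred X ℓ) →
                (∀ j → Open (S j)) → ∀ {T} → T ≐ ⋃ J S → Open T

record OrderedSpace (c ℓ₁ ℓ : Level) : Set (suc (c ⊔ ℓ₁ ⊔ suc ℓ)) where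
  field
    poset : Poset c ℓ₁ ℓ

  open Poset poset public

  field
    Open       : Pred Carrier ℓ → Set (c ⊔ ℓ)
    isTopology : IsTopology _≈_ Open

  open IsTopology isTopology public

  open-≐ : ∀ {S T} → S ≐ T → Open S → Open T
  open-≐ {S} (S⊆T , T⊆S) oS = open-⋃ {J = Unit.⊤} (λ _ → S) (λ _ → oS)
    ((λ x∈T → Unit.tt , T⊆S x∈T) , λ (_ , x∈S) → S⊆T x∈S)

  Closed : Pred Carrier ℓ → Set (c ⊔ ℓ)
  Closed S = Open (∁ S)

  Downset : Pred Carrier ℓ → Set (c ⊔ ℓ)
  Downset S = ∀ {x y} → x ≤ y → y ∈ S → x ∈ S

  Upset : Pred Carrier ℓ → Set (c ⊔ ℓ)
  Upset S = ∀ {x y} → x ≤ y → x ∈ S → y ∈ S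

module _ (X : OrderedSpace c ℓ₁ ℓ) where

  open OrderedSpace X

  record OpenUpset : Set (c ⊔ suc ℓ) where
    field
      member  : Pred Carrier ℓ
      isOpen  : Open member
      isUpset : Upset member

  record ClosedUpset : Set (c ⊔ suc ℓ) where
    field
      member   : Pred Carrier ℓ
      isClosed : Closed member
      isUpset  : Upset member

  record ClosedDownset : Set (c ⊔ suc ℓ) where
    field
      member    : Pred Carrier ℓ
      isClosed  : Closed member
      isDownset : Downset member

record _≅_ {c c′ ℓ₁ ℓ₁′ ℓ} (X : OrderedSpace c ℓ₁ ℓ)
           (Y : OrderedSpace c′ ℓ₁′ ℓ) :
           Set (c ⊔ c′ ⊔ ℓ₁ ⊔ ℓ₁′ ⊔ suc ℓ) where
  private
    module X = OrderedSpace X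
    module Y = OrderedSpace Y

  field
    bijection : Inverse X.Eq.setoid Y.Eq.setoid

  open Inverse bijection public using (to; from)

  field
    to-continuous      : ∀ {S} → Y.Open S → X.Open (S ∘ to)
    from-continuous    : ∀ {S} → X.Open S → Y.Open (S ∘ from)
    isOrderIsomorphism : IsOrderIsomorphism X._≈_ Y._≈_ X._≤_ Y._≤_ to

infix 4 _≅_

module _ (L : BoundedDistributiveLattice ℓ) where

  private module L = BoundedDistributiveLattice L
  open PrimeFilter

  primeFilterPoset : Poset (suc ℓ) ℓ ℓ
  primeFilterPoset = record
    { Carrier = PrimeFilter L
    ; _≈_     = λ x y → member x ≐ member y
    ; _≤_     = λ x y → member x ⊆ member y
    ; isPartialOrder = record
      { isPreorder = record
        { isEquivalence = record
          { refl  = id , id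
          ; sym   = λ (p , q) → q , p
          ; trans = λ (p , q) (p′ , q′) → (λ a → p′ (p a)) , (λ a → q (q′ a))
          }
        ; reflexive = proj₁
        ; trans     = λ p q a → q (p a)
        }
      ; antisym = _,_
      }
    }

  basic : L.Carrier → L.Carrier → Pred (PrimeFilter L) ℓ
  basic a b = α L a ∩ ∁ (α L b)

  PriestleyOpen : Pred (PrimeFilter L) ℓ → Set (suc ℓ)
  PriestleyOpen S = ∀ x → x ∈ S → ∃₂ λ a b → x ∈ basic a b × basic a b ⊆ S

  priestleyTopology :
    IsTopology (Poset._≈_ primeFilterPoset) PriestleyOpen
  priestleyTopology = record
    { open-resp = λ {_} oS {x} (x⊆y , y⊆x) x∈S →
        let a , b , (a∈x , b∉x) , sub = oS x x∈S
        in sub (x⊆y a∈x , λ b∈y → b∉x (y⊆x b∈y))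
    ; open-U = λ (_ , all) x _ →
        L.⊤ , L.⊥ , (⊤∈ x , proper x) , λ _ → all _
    ; open-∩ = λ oS oT x (x∈S , x∈T) →
        let a , b , (a∈x , b∉x) , subS = oS x x∈S
            d , e , (d∈x , e∉x) , subT = oT x x∈T
        in a L.∧ d , b L.∨ e
         , (∧-closed x a∈x d∈x , λ b∨e∈x → case∨ x b∉x e∉x b∨e∈x)
         , λ {y} (a∧d∈y , b∨e∉y) →
             subS ( upClosed y (L.x∧y≤x a d) a∧d∈y
                  , λ b∈y → b∨e∉y (upClosed y (L.x≤x∨y b e) b∈y))
           , subT ( upClosed y (L.x∧y≤y a d) a∧d∈y
                  , λ e∈y → b∨e∉y (upClosed y (L.y≤x∨y b e) e∈y))
    ; open-⋃ = λ S oS (T⊆ , ⊆T) x x∈T →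
        let j , x∈Sj = T⊆ x∈T
            a , b , x∈B , sub = oS j x x∈Sj
        in a , b , x∈B , λ y∈B → ⊆T (j , sub y∈B)
    }
    where
    case∨ : ∀ x {b e} → b ∉ member x → e ∉ member x → b L.∨ e ∉ member x
    case∨ x b∉ e∉ b∨e∈ with prime x b∨e∈
    ... | inj₁ b∈ = b∉ b∈
    ... | inj₂ e∈ = e∉ e∈

  priestleySpace : OrderedSpace (suc ℓ) ℓ ℓ
  priestleySpace = record
    { poset      = primeFilterPoset
    ; Open       = PriestleyOpen
    ; isTopology = priestleyTopology
    }

  openUpset : Ideal L → OpenUpset priestleySpace
  openUpset I = record
    { member  = ⋃ (∃ I.member) (λ (a , _) → α L a)
    ; isOpen  = λ x ((a , a∈I) , a∈x) →
        a , L.⊥ , (a∈x , proper x) , λ (a∈y , _) → (a , a∈I) , a∈y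
    ; isUpset = λ x≤y (i , a∈x) → i , x≤y a∈x
    }
    where module I = Ideal I

  -- Classical logic gives, for x outside the intersection, an a ∈ F with a ∉ x.

  closedUpset : ExcludedMiddle ℓ → Filter L → ClosedUpset priestleySpace
  closedUpset em F = record
    { member   = ⋂ (∃ F.member) (λ (a , _) → α L a)
    ; isClosed = closed
    ; isUpset  = λ x≤y x∈ i → x≤y (x∈ i)
    }
    where
    module F = Filter F
    closed : PriestleyOpen (∁ (⋂ (∃ F.member) (λ (a , _) → α L a)))
    closed x x∉ with em {Σ (∃ F.member) (λ (a , _) → a ∉ member x)}
    ... | yes (i@(a , _) , a∉x) =
          L.⊤ , a , (⊤∈ x , a∉x) , λ (_ , a∉y) y∈ → a∉y (y∈ i)
    ... | no none = contradiction
          (λ i → decidable-stable em (λ a∉x → none (i , a∉x))) x∉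

module _ (X : OrderedSpace c ℓ₁ ℓ) where

  open OrderedSpace X

  -- Closedness of X ∖ V is openness of the double complement of V, whence the
  -- appeal to classical logic.

  complement : ExcludedMiddle ℓ → OpenUpset X → ClosedDownset X
  complement em V = record
    { member    = ∁ V.member
    ; isClosed  = open-≐ ((λ x∈V x∉V → x∉V x∈V) , decidable-stable em) V.isOpen
    ; isDownset = λ x≤y y∉V x∈V → y∉V (V.isUpset x≤y x∈V)
    }
    where module V = OpenUpset V

-- Compactness and the separation axiom of Priestley spaces play no role in
-- this construction.  The coproduct _⊎_ makes X and Y disjoint.

module _ (X Y : OrderedSpace c ℓ₁ ℓ)
         (D : ClosedDownset X) (U : ClosedUpset Y) where

  private
    module X = OrderedSpace X
    module Y = OrderedSpace Y
    module D = ClosedDownset D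
    module U = ClosedUpset U

  DownUpOrder : Rel (X.Carrier ⊎ Y.Carrier) ℓ
  DownUpOrder (inj₁ x) (inj₁ y) = x X.≤ y
  DownUpOrder (inj₂ x) (inj₂ y) = x Y.≤ y
  DownUpOrder (inj₁ x) (inj₂ y) = x ∈ D.member × y ∈ U.member
  DownUpOrder (inj₂ _) (inj₁ _) = Empty.⊥

  private
    trans : ∀ {x y z} → DownUpOrder x y → DownUpOrder y z → DownUpOrder x z
    trans {inj₁ _} {inj₁ _} {inj₁ _} p q       = X.trans p q
    trans {inj₁ _} {inj₁ _} {inj₂ _} p (d , u) = D.isDownset p d , u
    trans {inj₁ _} {inj₂ _} {inj₂ _} (d , u) q = d , U.isUpset q u
    trans {inj₂ _} {inj₂ _} {inj₂ _} p q       = Y.trans p q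

    antisym : ∀ {x y} → DownUpOrder x y → DownUpOrder y x →
              Pointwise X._≈_ Y._≈_ x y
    antisym {inj₁ _} {inj₁ _} p q = inj₁ (X.antisym p q)
    antisym {inj₂ _} {inj₂ _} p q = inj₂ (Y.antisym p q)

    reflexive : ∀ {x y} → Pointwise X._≈_ Y._≈_ x y → DownUpOrder x y
    reflexive (inj₁ p) = X.reflexive p
    reflexive (inj₂ p) = Y.reflexive p

  downUpSum : OrderedSpace c (c ⊔ ℓ₁) ℓ
  downUpSum = record
    { poset = record
      { Carrier        = X.Carrier ⊎ Y.Carrier
      ; _≈_            = Pointwise X._≈_ Y._≈_
      ; _≤_            = DownUpOrder
      ; isPartialOrder = record
        { isPreorder = record
          { isEquivalence = ⊎-isEquivalence X.isEquivalence Y.isEquivalence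
          ; reflexive     = reflexive
          ; trans         = λ {x} {y} {z} → trans {x} {y} {z}
          }
        ; antisym = antisym
        }
      }
    ; Open       = λ S → X.Open (S ∘ inj₁) × Y.Open (S ∘ inj₂)
    ; isTopology = record
      { open-resp = λ where
          (oX , _) (inj₁ p) → X.open-resp oX p
          (_ , oY) (inj₂ p) → Y.open-resp oY p
      ; open-U    = λ (_ , all) → X.open-U ((λ _ → _) , λ _ → all _)
                                , Y.open-U ((λ _ → _) , λ _ → all _)
      ; open-∩    = λ (oX , oY) (oX′ , oY′) →
          X.open-∩ oX oX′ , Y.open-∩ oY oY′
      ; open-⋃    = λ S oS (T⊆ , ⊆T) →
            X.open-⋃ (λ j → S j ∘ inj₁) (λ j → proj₁ (oS j)) (T⊆ , ⊆T)
          , Y.open-⋃ (λ j → S j ∘ inj₂) (λ j → proj₂ (oS j)) (T⊆ , ⊆T)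
      }
    }

{-# OPTIONS --safe #-}

-- A point x of X yields the prime filter {(l , m) | l ∈ x} of the product, and
-- a point y of Y yields {(l , m) | m ∈ y}.  The element (⊥ , ⊤), which always
-- belongs to the ideal-filter product, tells the two kinds apart: a prime
-- filter z containing it is determined by the (⊥ , m) ∈ z, because
-- (l , m) ∧ (⊥ , ⊤) = (⊥ , m), and a z avoiding it by the (l , ⊤) ∈ z, because
-- (l , m) ∨ (⊥ , ⊤) = (l , ⊤).

module Submission where

open import Defs
open import Axiom.ExcludedMiddle using (ExcludedMiddle)
open import Data.Product.Base using (∃₂; _×_; _,_)
open import Data.Sum.Base using (inj₁; inj₂; [_,_])
open import Function.Base using (id; _∘_)
open import Level using (suc)
open import Relation.Nullary using (Dec; yes; no; contradiction)
open import Relation.Unary using (_∈_; _∉_; _⊆_)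

module _ {ℓ} (em : ExcludedMiddle ℓ) (L M : BoundedDistributiveLattice ℓ)
         (I : Ideal L) (F : Filter M) where

  private
    module L = BoundedDistributiveLattice L
    module M = BoundedDistributiveLattice M
    module I = Ideal I
    module F = Filter F

    N : BoundedDistributiveLattice ℓ
    N = idealFilterProduct L M I F

    module N = BoundedDistributiveLattice N

    X Y Z : OrderedSpace (suc ℓ) ℓ ℓ
    X = priestleySpace L
    Y = priestleySpace M
    Z = priestleySpace N

    S : OrderedSpace (suc ℓ) (suc ℓ) ℓ
    S = downUpSum X Y (complement X em (openUpset L I)) (closedUpset M em F)

    module X = OrderedSpace X
    module Y = OrderedSpace Y
    module Z = OrderedSpace Z
    module S = OrderedSpace S

    open PrimeFilter

    ⊥⊤ : N.Carrier
    ⊥⊤ = (L.⊥ , M.⊤) , inj₁ I.⊥∈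

    ⊥, : M.Carrier → N.Carrier
    ⊥, m = (L.⊥ , m) , inj₁ I.⊥∈

    ,⊤ : L.Carrier → N.Carrier
    ,⊤ l = (l , M.⊤) , inj₂ F.⊤∈

  pullbackˡ : X.Carrier → Z.Carrier
  pullbackˡ x = record
    { member        = λ ((l , _) , _) → l ∈ member x
    ; isPrimeFilter = record
      { isFilter = record
        { ⊤∈       = ⊤∈ x
        ; ∧-closed = ∧-closed x
        ; upClosed = λ (l≤l′ , _) → upClosed x l≤l′
        }
      ; proper = proper x
      ; prime  = prime x
      }
    }

  pullbackʳ : Y.Carrier → Z.Carrier
  pullbackʳ y = record
    { member        = λ ((_ , m) , _) → m ∈ member y
    ; isPrimeFilter = record
      { isFilter = record
        { ⊤∈       = ⊤∈ y
        ; ∧-closed = ∧-closed y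
        ; upClosed = λ (_ , m≤m′) → upClosed y m≤m′
        }
      ; proper = proper y
      ; prime  = prime y
      }
    }

  pullback : S.Carrier → Z.Carrier
  pullback = [ pullbackˡ , pullbackʳ ]

  -- In the mixed case an element `(l , m)` of the product has `l ∈ I` or `m ∈ F`. A point of `D`
  -- contains no element of `I` and a point of `U` contains all of `F`, so `l ∈ x` leads to `m ∈ y`
  -- either way.
  pullback-mono : ∀ p q → p S.≤ q → pullback p Z.≤ pullback q
  pullback-mono (inj₁ _) (inj₁ _) x≤x′ l∈x = x≤x′ l∈x
  pullback-mono (inj₂ _) (inj₂ _) y≤y′ m∈y = y≤y′ m∈y
  pullback-mono (inj₁ _) (inj₂ _) (x∈D , _) {_ , inj₁ l∈I} l∈x =
    contradiction ((_ , l∈I) , l∈x) x∈D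
  pullback-mono (inj₁ _) (inj₂ _) (_ , y∈U) {_ , inj₂ m∈F} _ =
    y∈U (_ , m∈F)

  pullback-cancel : ∀ p q → pullback p Z.≤ pullback q → p S.≤ q
  pullback-cancel (inj₁ _) (inj₁ _) le {l} = le {,⊤ l}
  pullback-cancel (inj₂ _) (inj₂ _) le {m} = le {⊥, m}
  -- As `y` is proper, the inclusion at `(l , ⊥)` with `l ∈ I` shows that `x` misses `I`; at
  -- `(⊤ , m)` with `m ∈ F` it shows that `y` contains `F`.
  pullback-cancel (inj₁ x) (inj₂ y) le =
      (λ ((l , l∈I) , l∈x) → proper y (le {(l , M.⊥) , inj₁ l∈I} l∈x))
    , (λ (m , m∈F) → le {(L.⊤ , m) , inj₂ m∈F} (⊤∈ x))
  pullback-cancel (inj₂ y) (inj₁ x) le =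
    contradiction (le {⊥⊤} (⊤∈ y)) (proper x)

  pullback-injective : ∀ p q → pullback p Z.≈ pullback q → p S.≈ q
  pullback-injective p q (le , ge) =
    S.antisym {p} {q} (pullback-cancel p q le) (pullback-cancel q p ge)

  pullback-cong : ∀ p q → p S.≈ q → pullback p Z.≈ pullback q
  pullback-cong p q p≈q =
      pullback-mono p q (S.reflexive {p} {q} p≈q)
    , pullback-mono q p (S.reflexive {q} {p} (S.Eq.sym {p} {q} p≈q))

  -- The map `,⊤` preserves `⊤`, `∧` and `∨` up to `≈` but sends `⊥` to `⊥⊤`, so properness is
  -- exactly the hypothesis on `z`.
  restrictˡ : (z : Z.Carrier) → ⊥⊤ ∉ member z → X.Carrier
  restrictˡ z ⊥⊤∉z = record
    { member        = λ l → ,⊤ l ∈ member z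
    ; isPrimeFilter = record
      { isFilter = record
        { ⊤∈       = upClosed z (L.refl , M.refl) (⊤∈ z)
        ; ∧-closed = λ a∈ b∈ →
            upClosed z (L.refl , M.maximum _) (∧-closed z a∈ b∈)
        ; upClosed = λ a≤b → upClosed z (a≤b , M.refl)
        }
      ; proper = λ ⊥∈ → ⊥⊤∉z (upClosed z (L.refl , M.refl) ⊥∈)
      ; prime  = λ {a} {b} a∨b∈ →
          prime z {,⊤ a} {,⊤ b} (upClosed z (L.refl , M.x≤x∨y _ _) a∨b∈)
      }
    }

  -- Dually, `⊥,` preserves `⊥`, `∧` and `∨` but sends `⊤` to `⊥⊤`, so here the hypothesis supplies
  -- the top element.
  restrictʳ : (z : Z.Carrier) → ⊥⊤ ∈ member z → Y.Carrier
  restrictʳ z ⊥⊤∈z = record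
    { member        = λ m → ⊥, m ∈ member z
    ; isPrimeFilter = record
      { isFilter = record
        { ⊤∈       = ⊥⊤∈z
        ; ∧-closed = λ a∈ b∈ →
            upClosed z (L.x∧y≤x _ _ , M.refl) (∧-closed z a∈ b∈)
        ; upClosed = λ a≤b → upClosed z (L.refl , a≤b)
        }
      ; proper = λ ⊥∈ → proper z (upClosed z (L.refl , M.refl) ⊥∈)
      ; prime  = λ {a} {b} a∨b∈ →
          prime z {⊥, a} {⊥, b} (upClosed z (L.minimum _ , M.refl) a∨b∈)
      }
    }

  -- The decision is a separate argument so that proofs can match on it instead of on `em`.
  restrict : (z : Z.Carrier) → Dec (⊥⊤ ∈ member z) → S.Carrier
  restrict z (yes ⊥⊤∈z) = inj₂ (restrictʳ z ⊥⊤∈z)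
  restrict z (no ⊥⊤∉z)  = inj₁ (restrictˡ z ⊥⊤∉z)

  pullback-restrict : ∀ z d → pullback (restrict z d) Z.≈ z
  pullback-restrict z (yes ⊥⊤∈z) =
      upClosed z (L.minimum _ , M.refl)
    , λ lm∈z → upClosed z (L.x∧y≤y _ _ , M.x∧y≤x _ _) (∧-closed z lm∈z ⊥⊤∈z)
  pullback-restrict z (no ⊥⊤∉z) =
      -- Since `(l , ⊤)` lies below `n ∨ ⊥⊤`, primeness puts `n` or `⊥⊤` into `z`, and the latter is
      -- excluded.
      (λ {n} l⊤∈z →
        [ id , (λ ⊥⊤∈z → contradiction ⊥⊤∈z ⊥⊤∉z) ]
        (prime z {n} {⊥⊤} (upClosed z (L.x≤x∨y _ _ , M.y≤x∨y _ _) l⊤∈z)))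
    , upClosed z (L.refl , M.maximum _)

  -- On each summand, the preimage of a basic set is the basic set given by the corresponding
  -- coordinates.
  pullback-continuous : ∀ P → Z.Open P → S.Open (P ∘ pullback)
  pullback-continuous _ oP =
      (λ x x∈P →
        let ((a , _) , _) , ((b , _) , _) , x∈B , B⊆P = oP (pullbackˡ x) x∈P
        in a , b , x∈B , λ {x′} → B⊆P {pullbackˡ x′})
    , (λ y y∈P →
        let ((_ , a) , _) , ((_ , b) , _) , y∈B , B⊆P = oP (pullbackʳ y) y∈P
        in a , b , y∈B , λ {y′} → B⊆P {pullbackʳ y′})

  -- A basic set around the restriction of `z`, carried over along `⊥,` or `,⊤`, contains only
  -- filters that agree with `z` about `⊥⊤`, so `restrict` sends all of it into one summand.
  restrict-continuous : ∀ P → S.Open P → Z.Open (λ z → restrict z em ∈ P)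
  restrict-continuous P (oX , oY) z = neighbourhood em
    where
    neighbourhood : ∀ d → restrict z d ∈ P →
      ∃₂ λ a b → z ∈ basic N a b × basic N a b ⊆ λ z′ → restrict z′ em ∈ P
    neighbourhood (yes ⊥⊤∈z) y∈P with oY _ y∈P
    ... | a , b , z∈B , B⊆P = ⊥, a , ⊥, b , z∈B , λ {z′} → inside z′ em
      where
      inside : ∀ z′ d → z′ ∈ basic N (⊥, a) (⊥, b) → restrict z′ d ∈ P
      inside z′ (yes _)     z′∈B       = B⊆P z′∈B
      -- `(⊥ , a) ≤ ⊥⊤`, so a filter containing the former contains `⊥⊤`.
      inside z′ (no ⊥⊤∉z′) (⊥a∈z′ , _) =
        contradiction (upClosed z′ (L.refl , M.maximum _) ⊥a∈z′) ⊥⊤∉z′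
    neighbourhood (no ⊥⊤∉z) x∈P with oX _ x∈P
    ... | a , b , z∈B , B⊆P = ,⊤ a , ,⊤ b , z∈B , λ {z′} → inside z′ em
      where
      inside : ∀ z′ d → z′ ∈ basic N (,⊤ a) (,⊤ b) → restrict z′ d ∈ P
      inside z′ (no _)      z′∈B        = B⊆P z′∈B
      -- `⊥⊤ ≤ (b , ⊤)`, so a filter avoiding the latter avoids `⊥⊤`.
      inside z′ (yes ⊥⊤∈z′) (_ , b⊤∉z′) =
        contradiction (upClosed z′ (L.minimum _ , M.refl) ⊥⊤∈z′) b⊤∉z′

  -- Injectivity of `pullback` reduces this to `pullback-restrict`. Both `from-cong` and one of the
  -- inverse laws are instances.
  restrict-unique : ∀ p z d → z Z.≈ pullback p → restrict z d S.≈ p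
  restrict-unique p z d z≈p = pullback-injective (restrict z d) p
    (Z.Eq.trans {pullback (restrict z d)} {z} {pullback p}
      (pullback-restrict z d) z≈p)

  pullback-≅ : S ≅ Z
  pullback-≅ = record
    { bijection = record
      { to        = pullback
      ; from      = λ z → restrict z em
      ; to-cong   = λ {p} {q} → pullback-cong p q
      ; from-cong = λ {z} {z′} z≈z′ → restrict-unique (restrict z′ em) z em
          (Z.Eq.trans {z} {z′} {pullback (restrict z′ em)} z≈z′
            (Z.Eq.sym {pullback (restrict z′ em)} {z′} (pullback-restrict z′ em)))
      ; inverse   = (λ {z} {p} → section z p)
                  , λ {p} {z} → restrict-unique p z em
      }
    ; to-continuous      = λ {P} → pullback-continuous P
    ; from-continuous    = λ {P} → restrict-continuous P
    ; isOrderIsomorphism = record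
      { isOrderMonomorphism = record
        { isOrderHomomorphism = record
          { cong = λ {p} {q} → pullback-cong p q
          ; mono = λ {p} {q} → pullback-mono p q
          }
        ; injective = λ {p} {q} → pullback-injective p q
        ; cancel    = λ {p} {q} → pullback-cancel p q
        }
      ; surjective = λ z → restrict z em , λ {p} → section z p
      }
    }
    where
    section : ∀ z p → p S.≈ restrict z em → pullback p Z.≈ z
    section z p p≈z = Z.Eq.trans {pullback p} {pullback (restrict z em)} {z}
      (pullback-cong p (restrict z em) p≈z) (pullback-restrict z em)

theorem4p5 :
    ∀ {ℓ} (em : ExcludedMiddle ℓ)
    (L M : BoundedDistributiveLattice ℓ) (I : Ideal L) (F : Filter M) →
    let X = priestleySpace L
        Y = priestleySpace M
        V = openUpset L I
        D = complement X em V
        U = closedUpset M em F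
    in downUpSum X Y D U ≅ priestleySpace (idealFilterProduct L M I F)
theorem4p5 = pullback-≅
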